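{- If every tree is graceful, then every tree is supergraceful.
   Context: A graceful labeling of a graph with $q$ edges is an injective map $\varphi: V \to \{0,\dots,q\}$ whose induced edge labels $|\varphi(u)-\varphi(v)|$, $uv\in E$, are pairwise distinct. For a graph with $p$ nodes and $q$ edges, a total labeling is a map $\varphi: V \to \{1,\dots,p+q\}$ such that the $p$ node labels and the $q$ edge labels $|\varphi(u)-\varphi(v)|$ are all pairwise distinct, together forming exactly $\{1,\dots,p+q\}$; a graph is supergraceful if it admits a total labeling. -}

module Defs where

open import Level using (0ℓ)
open import Data.Nat using (ℕ; _+_; _≤_; ∣_-_∣)
open import Data.Fin using (Fin; _<_)
open import Data.Fin.Properties using (_<?_)
open import Data.List using (List; _∷_; _++_; _∷ʳ_; map; length; filter; allFin; cartesianProduct)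
open import Data.List.Membership.Propositional using (_∈_)
open import Data.List.Relation.Unary.Linked using (Linked)
open import Data.List.Relation.Unary.Unique.Propositional using (Unique)
open import Data.Product using (_×_; _,_; ∃)
open import Function.Bundles using (_⇔_)
open import Function.Definitions using (Injective)
open import Relation.Binary using (Rel; Decidable; Symmetric; Irreflexive)
open import Relation.Binary.Construct.Closure.ReflexiveTransitive using (Star)
open import Relation.Binary.PropositionalEquality using (_≡_)
open import Relation.Nullary using (¬_)
open import Relation.Nullary.Decidable using (_×-dec_)

-- Finite simple graphs, with node set Fin p.  Adjacency is decidable so that
-- edges can be counted.
record Graph : Set₁ where
  field
    p          : ℕ
    Adj        : Rel (Fin p) 0ℓ
    adj?       : Decidable Adj
    adj-sym    : Symmetric Adj
    adj-irrefl : Irreflexive _≡_ Adj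

  Node : Set
  Node = Fin p

  -- Each undirected edge uv is listed exactly once, as the pair with u < v.
  edges : List (Node × Node)
  edges = filter (λ (u , v) → (u <? v) ×-dec adj? u v)
                 (cartesianProduct (allFin p) (allFin p))

  q : ℕ
  q = length edges

  -- The first component says that there is at least one node.
  Connected : Set
  Connected = Node × (∀ u v → Star Adj u v)

  -- The cycle u, vs, u: its nodes u ∷ vs are distinct and at least three.
  IsCycle : Node → List Node → Set
  IsCycle u vs = 3 ≤ length (u ∷ vs) × Unique (u ∷ vs) × Linked Adj (u ∷ vs ∷ʳ u)

  Acyclic : Set
  Acyclic = ∀ u vs → ¬ IsCycle u vs

  IsTree : Set
  IsTree = Connected × Acyclic

  edgeLabels : (Node → ℕ) → List ℕ
  edgeLabels φ = map (λ (u , v) → ∣ φ u - φ v ∣) edges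

  record IsGracefulLabeling (φ : Node → ℕ) : Set where
    field
      range          : ∀ v → φ v ≤ q
      injective      : Injective _≡_ _≡_ φ
      edges-distinct : Unique (edgeLabels φ)

  Graceful : Set
  Graceful = ∃ IsGracefulLabeling

  allLabels : (Node → ℕ) → List ℕ
  allLabels φ = map φ (allFin p) ++ edgeLabels φ

  record IsTotalLabeling (φ : Node → ℕ) : Set where
    field
      range    : ∀ v → 1 ≤ φ v × φ v ≤ p + q
      distinct : Unique (allLabels φ)
      exact    : ∀ k → k ∈ allLabels φ ⇔ (1 ≤ k × k ≤ p + q)

  Supergraceful : Set
  Supergraceful = ∃ IsTotalLabeling

{-# OPTIONS --safe #-}
-- If g is a graceful labeling then 2g + 1 is a total labeling: the node labels
-- are odd, the edge labels 2∣g u - g v∣ are even and nonzero, and everything is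
-- at most 2q + 1, which is p + q as soon as q < p.  The labels are then p + q distinct
-- numbers in {1, …, p + q}, hence all of them.
--
-- That an acyclic graph with a node has q < p is a union-find argument: insert
-- the edges one at a time, keeping a representative for each component.  As no
-- edge closes a cycle, every insertion retires one representative, and a
-- representative that is still in use remains at the end.
module Submission where

open import Defs

open import Level using (Level; 0ℓ)
open import Data.Nat as ℕ using (ℕ; suc; _+_; _*_; _≤_; z≤n; s≤s; ∣_-_∣)
import Data.Nat.Properties as ℕ
open import Data.Fin using (Fin; zero; suc; _<_)
import Data.Fin.Properties as Fin
open import Data.List using (List; []; _∷_; _∷ʳ_; map; length; lookup; allFin; upTo; cartesianProduct)
open import Data.List.Properties using (map-cong; map-∘; length-map; length-upTo; length-tabulate; length-++)
open import Data.List.Membership.Propositional using (_∈_; _∉_)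
open import Data.List.Membership.Propositional.Properties
  using (∈-lookup; ∈-map⁺; ∈-map⁻; ∈-++⁻; ∈-upTo⁺; ∈-allFin; ∈-filter⁻)
open import Data.List.Relation.Binary.Subset.Propositional using (_⊆_)
open import Data.List.Relation.Unary.All as All using (All; []; _∷_)
open import Data.List.Relation.Unary.All.Properties using (¬Any⇒All¬)
open import Data.List.Relation.Unary.AllPairs using ([]; _∷_)
open import Data.List.Relation.Unary.Any using (here; there; index)
open import Data.List.Relation.Unary.Any.Properties using (lookup-index)
open import Data.List.Relation.Unary.Linked using (Linked; [-]; _∷_)
open import Data.List.Relation.Unary.Unique.Propositional using (Unique)
import Data.List.Relation.Unary.Unique.Propositional.Properties as Unique
open import Data.Product using (_×_; _,_; ∃; proj₁; proj₂)
open import Data.Sum as Sum using (_⊎_; inj₁; inj₂)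
open import Function using (_∘_; mk⇔)
open import Function.Definitions using (Injective)
open import Relation.Binary using (Rel; DecidableEquality)
open import Relation.Binary.Construct.Closure.ReflexiveTransitive as Star using (Star; ε; _◅_; _◅◅_)
open import Relation.Binary.PropositionalEquality
open import Relation.Nullary using (¬_; yes; no; contradiction)
open import Relation.Nullary.Decidable using (_×-dec_)

private
  variable
    a : Level
    A : Set a
    xs ys : List A

-- Counting in lists without repetition

lookup-injective : Unique xs → Injective _≡_ _≡_ (lookup xs)
lookup-injective (_ ∷ _)   {zero}  {zero}  _  = refl
lookup-injective (x∉ ∷ _)  {zero}  {suc j} eq = contradiction eq (All.lookup x∉ (∈-lookup j))
lookup-injective (x∉ ∷ _)  {suc i} {zero}  eq = contradiction (sym eq) (All.lookup x∉ (∈-lookup i))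
lookup-injective (_ ∷ xs!) {suc i} {suc j} eq = cong suc (lookup-injective xs! eq)

-- Pigeonhole: each index of `xs` goes to a position of the same entry in `ys`. Equal positions
-- force equal entries, hence equal indices.
Unique∧⊆⇒length≤ : Unique xs → xs ⊆ ys → length xs ≤ length ys
Unique∧⊆⇒length≤ {xs = xs} {ys = ys} xs! xs⊆ys = Fin.injective⇒≤ position-injective
  where
  position : Fin (length xs) → Fin (length ys)
  position i = index (xs⊆ys (∈-lookup i))

  position-injective : Injective _≡_ _≡_ position
  position-injective {i} {j} eq = lookup-injective xs! (begin
    lookup xs i             ≡⟨ lookup-index (xs⊆ys (∈-lookup i)) ⟩
    lookup ys (position i)  ≡⟨ cong (lookup ys) eq ⟩
    lookup ys (position j)  ≡⟨ lookup-index (xs⊆ys (∈-lookup j)) ⟨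
    lookup xs j             ∎)
    where open ≡-Reasoning

module _ {A : Set a} (_≟_ : DecidableEquality A) where

  open import Data.List.Membership.DecPropositional _≟_ using (_∈?_)

  -- A `y` missing from `xs` could be prepended, giving a repetition-free list inside `ys` that is
  -- longer than `ys`.
  Unique∧⊆∧length≥⇒⊇ : {xs ys : List A} → Unique xs → xs ⊆ ys → length ys ≤ length xs → ys ⊆ xs
  Unique∧⊆∧length≥⇒⊇ {xs = xs} xs! xs⊆ys ys≤xs {y} y∈ys with y ∈? xs
  ... | yes y∈xs = y∈xs
  ... | no  y∉xs = contradiction
    (ℕ.≤-trans (Unique∧⊆⇒length≤ (¬Any⇒All¬ _ y∉xs ∷ xs!) λ where
      (here refl) → y∈ys
      (there z∈)  → xs⊆ys z∈) ys≤xs)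
    (ℕ.<-irrefl refl)

-- Loop erasure and closing paths

data Path {A : Set} (R : Rel A 0ℓ) : A → List A → A → Set where
  []  : ∀ {v} → Path R v [] v
  _∷_ : ∀ {u w v ws} → R u w → Path R w ws v → Path R u (w ∷ ws) v

module _ {A : Set} {R : Rel A 0ℓ} where

  SimplePath : A → A → Set
  SimplePath u v = ∃ λ ws → Unique (u ∷ ws) × Path R u ws v

  suffix : ∀ {u v w ws} → u ∈ (w ∷ ws) → Unique (w ∷ ws) → Path R w ws v → SimplePath u v
  suffix (here refl) ws!       π       = _ , ws! , π
  suffix (there u∈)  (_ ∷ ws!) (_ ∷ π) = suffix u∈ ws! π

  module _ (_≟_ : DecidableEquality A) where

    open import Data.List.Membership.DecPropositional _≟_ using (_∈?_)

    -- If the tail's simple path already visits `u`, the loop is cut by starting from that visit;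
    -- otherwise `u` is prepended.
    loop-erase : ∀ {u v} → Star R u v → SimplePath u v
    loop-erase ε = [] , [] ∷ [] , []
    loop-erase {u} (_◅_ {j = w} r rs) with loop-erase rs
    ... | ws , ws! , π with u ∈? (w ∷ ws)
    ...   | yes u∈ = suffix u∈ ws! π
    ...   | no  u∉ = w ∷ ws , ¬Any⇒All¬ _ u∉ ∷ ws! , r ∷ π

  -- Two relations occur because the closing edge is the one being inserted: it is an adjacency but
  -- not among the earlier edges.
  close : ∀ {S : Rel A 0ℓ} {u v ws z} → (∀ {x y} → R x y → S x y) →
          Path R u ws v → S v z → Linked S (u ∷ ws ∷ʳ z)
  close R⊆S []      s = s ∷ [-]
  close R⊆S (r ∷ π) s = R⊆S r ∷ close R⊆S π s

-- Union-find

module UnionFind {A : Set} (_≟_ : DecidableEquality A) where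

  Joined : List (A × A) → Rel A 0ℓ
  Joined es u v = (u , v) ∈ es ⊎ (v , u) ∈ es

  -- `retired` holds one former representative per inserted edge, which turns counting edges into
  -- counting distinct elements.
  record Components (es : List (A × A)) : Set where
    field
      rep            : A → A
      rep-sound      : ∀ {u v} → rep u ≡ rep v → Star (Joined es) u v
      retired        : List A
      retired-unique : Unique retired
      rep∉retired    : ∀ v → rep v ∉ retired
      retired-length : length retired ≡ length es

  singletons : Components []
  singletons = record
    { rep            = λ v → v
    ; rep-sound      = λ { refl → ε }
    ; retired        = []
    ; retired-unique = []
    ; rep∉retired    = λ _ ()
    ; retired-length = refl
    }

  module _ {es : List (A × A)} {a b : A} (C : Components es) where

    open Components C

    -- The class of `b` is redirected to `rep a`, so `rep b` falls out of use. It was in use until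
    -- now, hence is new to `retired`.
    merge : rep a ≢ rep b → Components ((a , b) ∷ es)
    merge a≢b = record
      { rep            = rep′
      ; rep-sound      = λ {u} {v} → rep′-sound u v
      ; retired        = rep b ∷ retired
      ; retired-unique = ¬Any⇒All¬ _ (rep∉retired b) ∷ retired-unique
      ; rep∉retired    = rep′∉
      ; retired-length = cong suc retired-length
      }
      where
      rep′ : A → A
      rep′ w with rep w ≟ rep b
      ... | yes _ = rep a
      ... | no  _ = rep w

      weaken : ∀ {u v} → rep u ≡ rep v → Star (Joined ((a , b) ∷ es)) u v
      weaken = Star.map (Sum.map there there) ∘ rep-sound

      rep′-sound : ∀ u v → rep′ u ≡ rep′ v → Star (Joined ((a , b) ∷ es)) u v
      rep′-sound u v eq with rep u ≟ rep b | rep v ≟ rep b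
      ... | yes u≡b | yes v≡b = weaken (trans u≡b (sym v≡b))
      -- The walk runs from `u` to `b`, crosses the new edge backwards, then goes from `a` to `v`;
      -- the next case is its mirror image.
      ... | yes u≡b | no  _   = weaken u≡b ◅◅ inj₂ (here refl) ◅ weaken eq
      ... | no  _   | yes v≡b = weaken eq ◅◅ inj₁ (here refl) ◅ weaken (sym v≡b)
      ... | no  _   | no  _   = weaken eq

      rep′∉ : ∀ w → rep′ w ∉ rep b ∷ retired
      rep′∉ w w∈ with rep w ≟ rep b
      rep′∉ w (here eq)  | yes _   = a≢b eq
      rep′∉ w (there w∈) | yes _   = rep∉retired a w∈
      rep′∉ w (here eq)  | no  w≢b = w≢b eq
      rep′∉ w (there w∈) | no  _   = rep∉retired w w∈

-- Acyclic graphs have fewer edges than nodes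

module _ (G : Graph) where

  open Graph G
  open UnionFind (Fin._≟_ {p})

  IsEdge : Node × Node → Set
  IsEdge (u , v) = u < v × Adj u v

  edges-sound : ∀ {e} → e ∈ edges → IsEdge e
  edges-sound = proj₂ ∘ ∈-filter⁻ (λ (u , v) → (u Fin.<? v) ×-dec adj? u v)
                                  {xs = cartesianProduct (allFin p) (allFin p)}

  edges-unique : Unique edges
  edges-unique = Unique.filter⁺ _ (Unique.cartesianProduct⁺ (Unique.allFin⁺ p) (Unique.allFin⁺ p))

  Joined⇒Adj : ∀ {es} → All IsEdge es → ∀ {u v} → Joined es u v → Adj u v
  Joined⇒Adj es-edges (inj₁ uv∈) = proj₂ (All.lookup es-edges uv∈)
  Joined⇒Adj es-edges (inj₂ vu∈) = adj-sym (proj₂ (All.lookup es-edges vu∈))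

  module _ (acyclic : Acyclic) where

    -- A simple path with at least two edges would form a cycle with `uv`. A shorter one is empty,
    -- against `u < v`, or one edge: `(u , v)` would be a repetition, and `(v , u)` has the wrong
    -- orientation.
    new-edge-separates : ∀ {u v es} → All IsEdge ((u , v) ∷ es) → Unique ((u , v) ∷ es) →
                         ¬ Star (Joined es) u v
    new-edge-separates {u} {v} {es} ((u<v , uv) ∷ es-edges) uv∷es! walk
      with loop-erase Fin._≟_ walk
    ... | [] , _ , [] = Fin.<-irrefl refl u<v
    ... | _ ∷ [] , _ , inj₁ uv∈ ∷ [] = Unique.Unique[x∷xs]⇒x∉xs uv∷es! uv∈
    ... | _ ∷ [] , _ , inj₂ vu∈ ∷ [] = Fin.<-asym u<v (proj₁ (All.lookup es-edges vu∈))
    ... | ws@(_ ∷ _ ∷ _) , ws! , π =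
      acyclic u ws (s≤s (s≤s (s≤s z≤n)) , ws! , close (Joined⇒Adj es-edges) π (adj-sym uv))

    components : ∀ {es} → All IsEdge es → Unique es → Components es
    components {[]} _ _ = singletons
    components {_ ∷ _} es-edges@(_ ∷ es-edges′) es!@(_ ∷ es!′) =
      merge C (new-edge-separates es-edges es! ∘ Components.rep-sound C)
      where C = components es-edges′ es!′

    -- The `q` retired nodes and `rep v` are `q + 1` distinct nodes.
    acyclic⇒q<p : Node → q ℕ.< p
    acyclic⇒q<p v = subst₂ _≤_ (cong suc retired-length) (length-tabulate (λ i → i))
      (Unique∧⊆⇒length≤ (¬Any⇒All¬ _ (rep∉retired v) ∷ retired-unique) (λ {x} _ → ∈-allFin x))
      where open Components (components (All.tabulate edges-sound) edges-unique)

  -- From a graceful labeling to a total one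

  module _ {g : Node → ℕ} (g-graceful : IsGracefulLabeling g) (q<p : q ℕ.< p) where

    open IsGracefulLabeling g-graceful

    φ : Node → ℕ
    φ v = suc (2 * g v)

    edgeLabels-φ : edgeLabels φ ≡ map (2 *_) (edgeLabels g)
    edgeLabels-φ = trans
      -- The `suc` in `φ` cancels by computation of `∣_-_∣`.
      (map-cong (λ (u , v) → sym (ℕ.*-distribˡ-∣-∣ 2 (g u) (g v))) edges)
      (map-∘ edges)

    φ-injective : Injective _≡_ _≡_ φ
    φ-injective = injective ∘ ℕ.*-cancelˡ-≡ _ _ 2 ∘ ℕ.suc-injective

    φ-bound : ∀ v → φ v ≤ p + q
    φ-bound v = begin
      suc (2 * g v)  ≤⟨ s≤s (ℕ.*-monoʳ-≤ 2 (range v)) ⟩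
      suc (2 * q)    ≡⟨ cong (λ r → suc (q + r)) (ℕ.+-identityʳ q) ⟩
      suc q + q      ≤⟨ ℕ.+-monoˡ-≤ q q<p ⟩
      p + q          ∎
      where open ℕ.≤-Reasoning

    φ-distinct : Unique (allLabels φ)
    φ-distinct = Unique.++⁺ (Unique.map⁺ φ-injective (Unique.allFin⁺ p))
      (subst Unique (sym edgeLabels-φ) (Unique.map⁺ (ℕ.*-cancelˡ-≡ _ _ 2) edges-distinct))
      disjoint
      where
      disjoint : ∀ {k} → ¬ (k ∈ map φ (allFin p) × k ∈ edgeLabels φ)
      disjoint (k∈nodes , k∈edges)
        with ∈-map⁻ φ k∈nodes | ∈-map⁻ (2 *_) (subst (_ ∈_) edgeLabels-φ k∈edges)
      ... | v , _ , k≡odd | m , _ , k≡even = ℕ.even≢odd m (g v) (trans (sym k≡even) k≡odd)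

    allLabels-range : ∀ {k} → k ∈ allLabels φ → 1 ≤ k × k ≤ p + q
    allLabels-range k∈ with ∈-++⁻ (map φ (allFin p)) k∈
    ... | inj₁ k∈nodes with v , _ , refl ← ∈-map⁻ φ k∈nodes = s≤s z≤n , φ-bound v
    ... | inj₂ k∈edges with (u , v) , uv∈ , refl ← ∈-map⁻ (λ (u , v) → ∣ φ u - φ v ∣) k∈edges =
      -- A zero label would identify the two ends of an edge, by injectivity of `φ`.
      ℕ.n≢0⇒n>0 (λ d≡0 → Fin.<⇒≢ (proj₁ (edges-sound uv∈)) (φ-injective (ℕ.∣m-n∣≡0⇒m≡n d≡0))) ,
      ℕ.≤-trans (ℕ.∣m-n∣≤m⊔n (φ u) (φ v)) (ℕ.⊔-lub (φ-bound u) (φ-bound v))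

    length-allLabels : length (allLabels φ) ≡ p + q
    length-allLabels = trans (length-++ (map φ (allFin p))) (cong₂ _+_
      (trans (length-map φ (allFin p)) (length-tabulate (λ i → i)))
      (length-map _ edges))

    allLabels-complete : ∀ {k} → 1 ≤ k × k ≤ p + q → k ∈ allLabels φ
    -- The list `map suc (upTo (p + q))` stands for the target interval; it is as long as the list
    -- of labels, so the inclusion reverses.
    allLabels-complete = Unique∧⊆∧length≥⇒⊇ ℕ._≟_ φ-distinct
      (∈-range ∘ allLabels-range) (ℕ.≤-reflexive (trans length-range (sym length-allLabels))) ∘ ∈-range
      where
      ∈-range : ∀ {k} → 1 ≤ k × k ≤ p + q → k ∈ map suc (upTo (p + q))
      ∈-range {suc k} (_ , k<) = ∈-map⁺ suc (∈-upTo⁺ k<)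

      length-range : length (map suc (upTo (p + q))) ≡ p + q
      length-range = trans (length-map suc (upTo (p + q))) (length-upTo (p + q))

    φ-total : IsTotalLabeling φ
    φ-total = record
      { range    = λ v → s≤s z≤n , φ-bound v
      ; distinct = φ-distinct
      ; exact    = λ k → mk⇔ allLabels-range allLabels-complete
      }

theorem7p9 : ((G : Graph) → Graph.IsTree G → Graph.Graceful G) →
    ((G : Graph) → Graph.IsTree G → Graph.Supergraceful G)
theorem7p9 graceful G tree@((v , _) , acyclic) =
  φ G g-graceful q<p , φ-total G g-graceful q<p
  where
  g-graceful = proj₂ (graceful G tree)
  q<p = acyclic⇒q<p G acyclic v
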